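{- Let $n\ge6$ be an even integer and $\pi\in S_n$ with $G_\pi$ connected. Then $\gamma(G_\pi)=n/2$ if and only if $G_\pi$ is a comb. Furthermore, there are exactly $2$ permutations $\pi\in S_n$ such that $G_\pi$ is connected and $\gamma(G_\pi)=n/2$.
   Context: For a permutation $\pi$ of $[n]=\{1,\dots,n\}$ (one-line notation $[\pi(1),\dots,\pi(n)]$), the permutation graph $G_\pi$ has vertex set $[n]$ and an edge between $i<j$ iff $\pi^{ -1}(i)>\pi^{ -1}(j)$. $\gamma(G)$ is the domination number (minimum size of a set $D$ such that every vertex is in $D$ or adjacent to a vertex of $D$). For even $n$, a graph $G$ on $n$ vertices is a comb if $V(G)$ can be partitioned into two sets $V_1,V_2$ of size $n/2$ such that the induced subgraph on $V_1$ is a path, the induced subgraph on $V_2$ has no edges, and the edges between $V_1$ and $V_2$ form a perfect matching. -}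

module Defs where

open import Data.Nat using (ℕ; suc; _≤_; _+_)
open import Data.Fin using (Fin; toℕ) renaming (_<_ to _<ᶠ_)
open import Data.Fin.Permutation using (Permutation′; _⟨$⟩ʳ_; _⟨$⟩ˡ_)
open import Data.Fin.Subset using (Subset; _∈_; ∣_∣)
open import Data.Product using (Σ; ∃; _×_; _,_)
open import Data.Sum using (_⊎_; inj₁; inj₂)
open import Function.Bundles using (_↔_; _⇔_; Inverse)
open import Relation.Binary.PropositionalEquality using (_≡_)
open import Relation.Nullary using (¬_)

-- A permutation π of [n] is represented on Fin n (vertices 0..n-1).
-- One-line notation [π(1),…,π(n)]: π ⟨$⟩ʳ p is the value at position p,
-- so π ⟨$⟩ˡ v = π⁻¹(v) is the position of the value v.

Adj : ∀ {n} → Permutation′ n → Fin n → Fin n → Set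
Adj π i j =
  (i <ᶠ j × (π ⟨$⟩ˡ j) <ᶠ (π ⟨$⟩ˡ i)) ⊎ (j <ᶠ i × (π ⟨$⟩ˡ i) <ᶠ (π ⟨$⟩ˡ j))

data Walk {n} (π : Permutation′ n) : Fin n → Fin n → Set where
  here : ∀ {u} → Walk π u u
  step : ∀ {u v w} → Adj π u v → Walk π v w → Walk π u w

Connected : ∀ {n} → Permutation′ n → Set
Connected π = ∀ u v → Walk π u v

Dominating : ∀ {n} → Permutation′ n → Subset n → Set
Dominating {n} π D = ∀ (v : Fin n) → v ∈ D ⊎ (∃ λ u → u ∈ D × Adj π u v)

DominationNumber : ∀ {n} → Permutation′ n → ℕ → Set
DominationNumber {n} π k =
  (∃ λ (D : Subset n) → Dominating π D × ∣ D ∣ ≡ k)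
  × (∀ (D : Subset n) → Dominating π D → k ≤ ∣ D ∣)

-- G_π is a comb (n = m + m): a bijection f : V₁ ⊎ V₂ ≅ [n] with V₁ = inj₁ (Fin m),
-- V₂ = inj₂ (Fin m) such that
--  * the induced subgraph on V₁ is a path (f ∘ inj₁ lists the path in order),
--  * V₂ is independent,
--  * the V₁–V₂ edges form a perfect matching.
IsComb : ∀ {n} → Permutation′ n → Set
IsComb {n} π = Σ ℕ λ m → Σ ((Fin m ⊎ Fin m) ↔ Fin n) λ e →
  let f = Inverse.to e in
    (∀ i j → Adj π (f (inj₁ i)) (f (inj₁ j)) ⇔ (suc (toℕ i) ≡ toℕ j ⊎ suc (toℕ j) ≡ toℕ i))
  × (∀ i j → ¬ Adj π (f (inj₂ i)) (f (inj₂ j)))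
  × (∀ i → ∃ λ j → Adj π (f (inj₁ i)) (f (inj₂ j))
                 × (∀ j′ → Adj π (f (inj₁ i)) (f (inj₂ j′)) → j′ ≡ j))
  × (∀ j → ∃ λ i → Adj π (f (inj₁ i)) (f (inj₂ j))
                 × (∀ i′ → Adj π (f (inj₁ i′)) (f (inj₂ j)) → i′ ≡ i))

SamePerm : ∀ {n} → Permutation′ n → Permutation′ n → Set
SamePerm {n} π σ = ∀ (p : Fin n) → π ⟨$⟩ʳ p ≡ σ ⟨$⟩ʳ p

{-# OPTIONS --safe #-}

-- Write u ⊏ v when u < v and v is positioned before u, so that G_π is the comparability graph
-- of ⊏. If G_π is connected, its ⊏-maximal and its ⊏-minimal vertices form two disjoint
-- dominating sets, so γ = n/2 forces them to have n/2 = m elements each and to exhaust [n].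
-- List them increasingly as u₀, …, uₘ₋₁ and d₀, …, dₘ₋₁; both lists increase in position too.
-- For each k, choosing u below the index k and d above it (or vice versa) must fail to dominate.
-- This gives uᵢ ~ dᵢ for all i, and then excludes uᵢ ~ dⱼ, uⱼ ~ dₖ with i < j < k,
-- as well as dᵢ ~ uⱼ, dⱼ ~ uₖ. Connectedness links any two consecutive indices, so the
-- two kinds of link alternate: the first one determines all comparisons, by value and by
-- position, hence π, and the resulting graph is a comb.
module Submission where

open import Defs
open import Data.Nat using (ℕ; _≤_; _*_)
open import Data.Fin.Permutation using (Permutation′)
open import Data.Product using (Σ; _×_)
open import Data.Sum using (_⊎_)
open import Function.Bundles using (_⇔_)
open import Relation.Binary.PropositionalEquality using (_≡_)
open import Relation.Nullary using (¬_)

open import Data.Bool using (Bool; true; false; not)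
open import Data.Bool.Properties using (not-involutive; ¬-not) renaming (_≟_ to _≟ᵇ_)
open import Data.Empty using (⊥)
open import Data.Fin as Fin using (Fin; zero; suc; toℕ; fromℕ<; inject₁; punchIn; punchOut)
  renaming (_<_ to _<ᶠ_; _≤_ to _≤ᶠ_)
open import Data.Fin.Induction using (<-wellFounded; >-wellFounded; <-weakInduction)
open import Data.Fin.Permutation using (_⟨$⟩ʳ_; _⟨$⟩ˡ_; inverseˡ; inverseʳ; ↔⇒≡)
open import Data.Fin.Properties
  using (_≟_; _<?_; any?; <-cmp; toℕ-injective; toℕ-fromℕ<; toℕ<n; toℕ-inject₁;
         injective⇒≤; punchOut-injective; punchIn-punchOut; +↔⊎; *↔×; 2↔Bool)
open import Data.Fin.Subset using (Subset; _∈_; _∉_; _⊆_; ∣_∣; ∁; inside; outside)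
open import Data.Fin.Subset.Properties
  using (_∈?_; p⊆q⇒∣p∣≤∣q∣; p⊂q⇒∣p∣<∣q∣; x∉p⇒x∈∁p; ∣∁p∣≡n∸∣p∣; ∣p∣≤n; ∈⊤; ∣⊤∣≡n)
open import Data.Nat as ℕ using (zero; suc; _+_; _<_; z≤n; s≤s; z<s; s<s; s≤s⁻¹)
import Data.Nat.Properties as ℕₚ
open import Data.Product using (∃; _,_; proj₁; proj₂)
open import Data.Product.Function.NonDependent.Propositional using (_×-↔_)
open import Data.Sum using (inj₁; inj₂; [_,_]′; swap)
open import Data.Sum.Properties using (inj₁-injective)
open import Data.Vec using (tabulate; []; _∷_; here; there)
open import Data.Vec.Properties using (lookup∘tabulate; []=⇒lookup; lookup⇒[]=)
open import Function using (_∘_; id; flip; Injective)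
open import Function.Bundles using (_↔_; Inverse; Equivalence; mk⇔; mk↔ₛ′)
open import Function.Construct.Composition using (_↔-∘_)
open import Function.Construct.Identity using (↔-id)
open import Function.Construct.Symmetry using (↔-sym)
open import Induction.WellFounded using (WellFounded; Acc; acc; module Subrelation)
open import Relation.Binary using (Decidable; Transitive; Trichotomous; tri<; tri≈; tri>; IsStrictTotalOrder)
open import Relation.Binary.Structures.Biased using (isStrictTotalOrderᶜ)
open import Relation.Binary.PropositionalEquality
  using (refl; sym; trans; cong; subst; subst₂; _≢_; isEquivalence)
open import Relation.Nullary using (Dec; yes; no; does; contradiction)
open import Relation.Nullary.Decidable using (_×-dec_; ¬?; dec-true)

private variable
  n m k : ℕ
  A : Set

↔-injective : {B : Set} (e : A ↔ B) → Injective _≡_ _≡_ (Inverse.to e)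
↔-injective e eq = trans (sym (Inverse.strictlyInverseʳ e _))
                     (trans (cong (Inverse.from e) eq) (Inverse.strictlyInverseʳ e _))

-- Subsets of Fin n

does-true⁻ : (d : Dec A) → does d ≡ true → A
does-true⁻ (yes a) _ = a

module _ {P : Fin n → Set} (P? : ∀ v → Dec (P v)) where

  comprehension : Subset n
  comprehension = tabulate (does ∘ P?)

  ∈-comprehension⁺ : ∀ {v} → P v → v ∈ comprehension
  ∈-comprehension⁺ {v} p =
    lookup⇒[]= v _ (trans (lookup∘tabulate (does ∘ P?) v) (dec-true (P? v) p))

  ∈-comprehension⁻ : ∀ {v} → v ∈ comprehension → P v
  ∈-comprehension⁻ {v} v∈ =
    does-true⁻ (P? v) (trans (sym (lookup∘tabulate (does ∘ P?) v)) ([]=⇒lookup v∈))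

-- The length is a parameter, so that an enumeration can be transported along an equation
-- `∣ p ∣ ≡ m`.
record Enumeration (p : Subset n) (k : ℕ) : Set where
  field
    at    : Fin k → Fin n
    mono  : ∀ {i j} → i <ᶠ j → at i <ᶠ at j
    at∈p  : ∀ i → at i ∈ p
    index : ∀ {v} → v ∈ p → ∃ λ i → at i ≡ v

  at-injective : Injective _≡_ _≡_ at
  at-injective {i} {j} eq with <-cmp i j
  ... | tri< i<j _ _ = contradiction (cong toℕ eq) (ℕₚ.<⇒≢ (mono i<j))
  ... | tri≈ _ i≡j _ = i≡j
  ... | tri> _ _ j<i = contradiction (cong toℕ (sym eq)) (ℕₚ.<⇒≢ (mono j<i))

open Enumeration

enumerate : (p : Subset n) → Enumeration p ∣ p ∣
enumerate []            = record { at = λ () ; mono = λ { {()} } ; at∈p = λ () ; index = λ () }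
enumerate (outside ∷ p) = record
  { at    = suc ∘ at E
  ; mono  = s<s ∘ mono E
  ; at∈p  = there ∘ at∈p E
  ; index = λ { (there v∈p) → let i , eq = index E v∈p in i , cong suc eq }
  } where E = enumerate p
enumerate (inside ∷ p) = record
  { at    = λ { zero → zero ; (suc i) → suc (at E i) }
  ; mono  = λ { {zero} {suc _} _ → z<s ; {suc _} {suc _} (s<s i<j) → s<s (mono E i<j) }
  ; at∈p  = λ { zero → here ; (suc i) → there (at∈p E i) }
  ; index = λ { here → zero , refl
              ; (there v∈p) → let i , eq = index E v∈p in suc i , cong suc eq }
  } where E = enumerate p

covered⇒∣p∣≤ : (p : Subset n) (c : Fin k → Fin n) → (∀ {v} → v ∈ p → ∃ λ a → c a ≡ v) → ∣ p ∣ ≤ k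
covered⇒∣p∣≤ p c cover = injective⇒≤ {f = λ i → proj₁ (preimage i)} λ {i} {j} eq →
  at-injective E (trans (sym (proj₂ (preimage i))) (trans (cong c eq) (proj₂ (preimage j))))
  where
  E = enumerate p
  preimage : ∀ i → ∃ λ a → c a ≡ at E i
  preimage i = cover (at∈p E i)

injective⇒≤∣p∣ : (p : Subset n) {g : Fin k → Fin n} → Injective _≡_ _≡_ g → (∀ j → g j ∈ p) → k ≤ ∣ p ∣
injective⇒≤∣p∣ p {g} g-inj g∈p = injective⇒≤ {f = λ j → proj₁ (index E (g∈p j))} λ {i} {j} eq →
  g-inj (trans (sym (proj₂ (index E (g∈p i)))) (trans (cong (at E) eq) (proj₂ (index E (g∈p j)))))
  where E = enumerate p

image : (Fin k → Fin n) → Subset n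
image c = comprehension (λ v → any? (λ a → c a ≟ v))

∣image∣≤ : (c : Fin k → Fin n) → ∣ image c ∣ ≤ k
∣image∣≤ c = covered⇒∣p∣≤ (image c) c (∈-comprehension⁻ (λ v → any? (λ a → c a ≟ v)))

∈-image : (c : Fin k → Fin n) (a : Fin k) → c a ∈ image c
∈-image c a = ∈-comprehension⁺ (λ v → any? (λ a → c a ≟ v)) (a , refl)

-- Finite strict total orders

-- If `y` were missed, punching it out of the codomain would inject `Fin (suc n)` into `Fin n`.
injective⇒surjective : {f : Fin n → Fin n} → Injective _≡_ _≡_ f → ∀ y → ∃ λ x → f x ≡ y
injective⇒surjective {suc n} {f} f-inj y with any? (λ x → f x ≟ y)
... | yes hit  = hit
... | no  miss = contradiction
  (injective⇒≤ {f = λ x → punchOut (avoids x)} λ {i} {j} eq →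
    f-inj (punchOut-injective (avoids i) (avoids j) eq))
  ℕₚ.1+n≰n
  where
  avoids : ∀ x → y ≢ f x
  avoids x y≡fx = miss (x , sym y≡fx)

mono⇒inflationary : (f : Fin n → Fin n) → (∀ {i j} → i <ᶠ j → f i <ᶠ f j) → ∀ i → i ≤ᶠ f i
mono⇒inflationary {suc n} f f-mono = <-weakInduction _ z≤n λ j j≤fj →
  ℕₚ.≤-<-trans (subst (_≤ toℕ (f (inject₁ j))) (toℕ-inject₁ j) j≤fj)
               (f-mono (s≤s (ℕₚ.≤-reflexive (toℕ-inject₁ j))))

module FiniteOrder {_≺_ : A → A → Set} (sto : IsStrictTotalOrder _≡_ _≺_) where
  open IsStrictTotalOrder sto using (compare; irrefl) renaming (trans to ≺-trans; _<?_ to _≺?_)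

  Embedding : A ↔ Fin n → Set
  Embedding e = ∀ {x y} → x ≺ y → Inverse.to e x <ᶠ Inverse.to e y

  reflects : (e : A ↔ Fin n) → Embedding e → ∀ {x y} → Inverse.to e x <ᶠ Inverse.to e y → x ≺ y
  reflects e emb {x} {y} lt with compare x y
  ... | tri< x≺y _ _  = x≺y
  ... | tri≈ _ refl _ = contradiction lt (ℕₚ.<-irrefl refl)
  ... | tri> _ _ y≺x  = contradiction lt (ℕₚ.<-asym (emb y≺x))

  private
    -- Going back along `e` and forth along `e′` is a strictly increasing self-map of `Fin n`, hence
    -- inflationary. Exchanging `e` and `e′` then gives uniqueness.
    ≤-embedding : (e e′ : A ↔ Fin n) → Embedding e → Embedding e′ →
                  ∀ x → Inverse.to e x ≤ᶠ Inverse.to e′ x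
    ≤-embedding e e′ emb emb′ x =
      subst (λ y → Inverse.to e x ≤ᶠ Inverse.to e′ y) (Inverse.strictlyInverseʳ e x)
        (mono⇒inflationary (Inverse.to e′ ∘ Inverse.from e)
          (λ {i} {j} i<j → emb′ (reflects e emb
            (subst₂ _<ᶠ_ (sym (Inverse.strictlyInverseˡ e i)) (sym (Inverse.strictlyInverseˡ e j)) i<j)))
          (Inverse.to e x))

  embedding-unique : (e e′ : A ↔ Fin n) → Embedding e → Embedding e′ →
                     ∀ x → Inverse.to e x ≡ Inverse.to e′ x
  embedding-unique e e′ emb emb′ x =
    toℕ-injective (ℕₚ.≤-antisym (≤-embedding e e′ emb emb′ x) (≤-embedding e′ e emb′ emb x))

  minimum↦0 : (e : A ↔ Fin n) → Embedding e → ∀ {x} → (∀ y → ¬ y ≺ x) → toℕ (Inverse.to e x) ≡ 0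
  minimum↦0 {zero} e emb {x} _ with () ← Inverse.to e x
  minimum↦0 {suc n} e emb {x} min with Inverse.to e x in eq
  ... | zero  = refl
  ... | suc i = contradiction
    (reflects e emb (subst₂ _<ᶠ_ (sym (Inverse.strictlyInverseˡ e zero)) (sym eq) (z<s {toℕ i})))
    (min _)

  -- An element is sent to the number of elements below it; `φ` turns these lower sets into subsets
  -- of `Fin n` that can be counted.
  embedding : A ↔ Fin n → ∃ λ (e : A ↔ Fin n) → Embedding e
  embedding {n} φ = mk↔ₛ′ rank unrank (proj₂ ∘ rank-surjective)
                      (λ x → rank-injective (proj₂ (rank-surjective (rank x))))
                  , rank-mono
    where
    open Inverse φ
    below? : ∀ x v → Dec (from v ≺ x)
    below? x v = from v ≺? x

    below : A → Subset n
    below x = comprehension (below? x)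

    to∈below : ∀ {x y} → x ≺ y → to x ∈ below y
    to∈below {x} x≺y = ∈-comprehension⁺ (below? _) (subst (_≺ _) (sym (strictlyInverseʳ x)) x≺y)

    to∉below : ∀ x → to x ∉ below x
    to∉below x to∈ = irrefl (strictlyInverseʳ x) (∈-comprehension⁻ (below? x) to∈)

    ∣below∣<n : ∀ x → ∣ below x ∣ < n
    ∣below∣<n x = subst (∣ below x ∣ <_) (∣⊤∣≡n n)
      (p⊂q⇒∣p∣<∣q∣ ((λ _ → ∈⊤) , to x , ∈⊤ , to∉below x))

    rank : A → Fin n
    rank x = fromℕ< (∣below∣<n x)

    rank-mono : ∀ {x y} → x ≺ y → rank x <ᶠ rank y
    rank-mono {x} {y} x≺y =
      subst₂ _<_ (sym (toℕ-fromℕ< (∣below∣<n x))) (sym (toℕ-fromℕ< (∣below∣<n y)))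
        (p⊂q⇒∣p∣<∣q∣ ((λ v∈ → ∈-comprehension⁺ (below? y)
                                (≺-trans (∈-comprehension⁻ (below? x) v∈) x≺y))
                     , to x , to∈below x≺y , to∉below x))

    rank-injective : ∀ {x y} → rank x ≡ rank y → x ≡ y
    rank-injective {x} {y} eq with compare x y
    ... | tri< x≺y _ _ = contradiction (cong toℕ eq) (ℕₚ.<⇒≢ (rank-mono x≺y))
    ... | tri≈ _ x≡y _ = x≡y
    ... | tri> _ _ y≺x = contradiction (cong toℕ (sym eq)) (ℕₚ.<⇒≢ (rank-mono y≺x))

    rank-surjective : ∀ v → ∃ λ x → rank x ≡ v
    rank-surjective v =
      let w , eq = injective⇒surjective {f = rank ∘ from}
                     (λ eq → trans (sym (strictlyInverseˡ _))
                               (trans (cong to (rank-injective eq)) (strictlyInverseˡ _))) v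
      in from w , eq

    unrank : Fin n → A
    unrank v = proj₁ (rank-surjective v)

-- Descent ends by well-foundedness, and transitivity relates its end to the start. It is applied
-- both to `_⊏_` and to its converse.
minimal-below : {R : Fin n → Fin n → Set} → Decidable R → Transitive R → WellFounded R →
                ∀ v → (¬ ∃ λ u → R u v) ⊎ ∃ λ u → R u v × ¬ ∃ λ w → R w u
minimal-below {n} {R} R? R-trans wf v = go v (wf v)
  where
  go : ∀ v → Acc R v → (¬ ∃ λ u → R u v) ⊎ ∃ λ u → R u v × ¬ ∃ λ w → R w u
  go v (acc rs) with any? (λ u → R? u v)
  ... | no min = inj₁ min
  ... | yes (u , Ruv) with go u (rs Ruv)
  ...   | inj₁ min             = inj₂ (u , Ruv , min)
  ...   | inj₂ (w , Rwu , min) = inj₂ (w , R-trans Rwu Ruv , min)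

-- Walks, combs and domination

Adj-sym : (π : Permutation′ n) → ∀ {u v} → Adj π u v → Adj π v u
Adj-sym π = swap

walk-trans : {π : Permutation′ n} → ∀ {u v w} → Walk π u v → Walk π v w → Walk π u w
walk-trans here         q = q
walk-trans (step uv p)  q = step uv (walk-trans p q)

walk-sym : {π : Permutation′ n} → ∀ {u v} → Walk π u v → Walk π v u
walk-sym         here        = here
walk-sym {π = π} (step uv p) = walk-trans (walk-sym p) (step (Adj-sym π uv) here)

crossing : {π : Permutation′ n} {P : Fin n → Set} → (∀ v → Dec (P v)) →
           ∀ {u w} → Walk π u w → P u → ¬ P w → ∃ λ x → ∃ λ y → Adj π x y × P x × ¬ P y
crossing P? here Pu ¬Pw = contradiction Pu ¬Pw
crossing P? (step {u} {v} uv p) Pu ¬Pw with P? v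
... | yes Pv = crossing P? p Pv ¬Pw
... | no ¬Pv = u , v , uv , Pu , ¬Pv

walk⇒neighbour : {π : Permutation′ n} → ∀ {u v} → Walk π u v → u ≢ v → ∃ λ w → Adj π u w
walk⇒neighbour here         u≢v = contradiction refl u≢v
walk⇒neighbour (step uw _)  _   = _ , uw

module Comb (π : Permutation′ n) (comb : IsComb π) where
  size  = proj₁ comb
  e     = proj₁ (proj₂ comb)
  path  = proj₁ (proj₂ (proj₂ comb))
  indep = proj₁ (proj₂ (proj₂ (proj₂ comb)))
  leaf  = proj₁ (proj₂ (proj₂ (proj₂ (proj₂ comb))))
  stem  = proj₂ (proj₂ (proj₂ (proj₂ (proj₂ comb))))

  open Inverse e using (to; from; strictlyInverseˡ)

  surjective : ∀ v → ∃ λ x → to x ≡ v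
  surjective v = from v , strictlyInverseˡ v

  path-walk : ∀ i j → Walk π (to (inj₁ i)) (to (inj₁ j))
  path-walk = go path
    where
    -- `size` is a projection and cannot be matched on; with a general length `k` the initial vertex
    -- `f zero` becomes available.
    go : ∀ {k} {f : Fin k → Fin n} →
         (∀ i j → Adj π (f i) (f j) ⇔ (suc (toℕ i) ≡ toℕ j ⊎ suc (toℕ j) ≡ toℕ i)) →
         ∀ i j → Walk π (f i) (f j)
    go {suc k} {f} adj i j = walk-trans (walk-sym (from-zero i)) (from-zero j)
      where
      from-zero : ∀ i → Walk π (f zero) (f i)
      from-zero = <-weakInduction _ here λ j w → walk-trans w
        (step (Equivalence.from (adj (inject₁ j) (suc j)) (inj₁ (cong suc (toℕ-inject₁ j)))) here)

  to-path : ∀ x → ∃ λ i → Walk π (to x) (to (inj₁ i))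
  to-path (inj₁ i) = i , here
  to-path (inj₂ j) = let i , ij , _ = stem j in i , step (Adj-sym π ij) here

  connected : Connected π
  connected u v with surjective u | surjective v
  ... | x , refl | y , refl =
    let i , xi = to-path x ; j , yj = to-path y
    in walk-trans xi (walk-trans (path-walk i j) (walk-sym yj))

  V₁ : Subset n
  V₁ = image (to ∘ inj₁)

  V₁-dominating : Dominating π V₁
  V₁-dominating v with surjective v
  ... | inj₁ i , refl = inj₁ (∈-image (to ∘ inj₁) i)
  ... | inj₂ j , refl = let i , ij , _ = stem j in inj₂ (_ , ∈-image (to ∘ inj₁) i , ij)

  module _ (D : Subset n) (D-dom : Dominating π D) where

    -- Teeth are independent and each has a single neighbour on the path, so only the tooth itself
    -- or its stem can dominate it.
    representative : ∀ j → ∃ λ x → to x ∈ D × (x ≡ inj₂ j ⊎ x ≡ inj₁ (proj₁ (stem j)))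
    representative j with D-dom (to (inj₂ j))
    ... | inj₁ ∈D = inj₂ j , ∈D , inj₁ refl
    ... | inj₂ (u , u∈D , adj) with surjective u
    ...   | inj₂ j′ , refl = contradiction adj (indep j′ j)
    ...   | inj₁ i  , refl =
      inj₁ i , u∈D , inj₂ (cong inj₁ (proj₂ (proj₂ (stem j)) i adj))

    stem-injective : ∀ {j j′} → proj₁ (stem j) ≡ proj₁ (stem j′) → j ≡ j′
    stem-injective {j} {j′} eq =
      let i , ij , _ = stem j ; i′ , i′j′ , _ = stem j′ ; _ , _ , unique = leaf i
      in trans (unique j ij)
               (sym (unique j′ (subst (λ i → Adj π (to (inj₁ i)) _) (sym eq) i′j′)))

    -- The pairs consisting of a tooth and its stem are disjoint, so a dominating set needs a
    -- separate element for each of them.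
    representative-injective : ∀ {j j′} → proj₁ (representative j) ≡ proj₁ (representative j′) → j ≡ j′
    representative-injective {j} {j′} eq
      with representative j | representative j′
    ... | _ , _ , inj₁ refl | _ , _ , inj₁ refl with refl ← eq = refl
    ... | _ , _ , inj₁ refl | _ , _ , inj₂ refl with () ← eq
    ... | _ , _ , inj₂ refl | _ , _ , inj₁ refl with () ← eq
    ... | _ , _ , inj₂ refl | _ , _ , inj₂ refl = stem-injective (inj₁-injective eq)

    size≤∣D∣ : size ≤ ∣ D ∣
    size≤∣D∣ = injective⇒≤∣p∣ D
      {g = to ∘ proj₁ ∘ representative}
      (representative-injective ∘ ↔-injective e)
      (λ j → proj₁ (proj₂ (representative j)))

  dominationNumber : DominationNumber π size
  dominationNumber =
    (V₁ , V₁-dominating , ℕₚ.≤-antisym (∣image∣≤ (to ∘ inj₁)) (size≤∣D∣ V₁ V₁-dominating)) , size≤∣D∣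

  -- `IsComb` brings its own half-size; counting the vertices identifies it with `m`.
  size≡ : n ≡ 2 * m → size ≡ m
  size≡ {m} n≡2m = ℕₚ.*-cancelˡ-≡ size m 2
    (trans (cong (size +_) (ℕₚ.+-identityʳ size)) (trans (↔⇒≡ (e ↔-∘ +↔⊎)) n≡2m))

-- The two comb permutations

bit : Bool → ℕ
bit false = 0
bit true  = 1

Label : ℕ → Set
Label m = Bool × Fin m

opposite : Label m → Label m
opposite (s , i) = not s , i

-- A cut-off for indices: the `false` labels preceding `(true , i)` in `Interleaved c` are those of
-- index at most `i`, and also the one of index `suc i` if `c i` is `true`.
threshold : (ℕ → Bool) → ℕ → ℕ
threshold c i = bit (c i) + suc i

-- The extra one that `c i` may contribute is absorbed by the strictness of `i < j`.
threshold-mono : ∀ c {i j} → i < j → threshold c i ≤ threshold c j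
threshold-mono c {i} {j} i<j with c i
... | false = ℕₚ.≤-trans (s≤s (ℕₚ.<⇒≤ i<j)) (ℕₚ.m≤n+m (suc j) (bit (c j)))
... | true  = ℕₚ.≤-trans (s≤s i<j) (ℕₚ.m≤n+m (suc j) (bit (c j)))

<-threshold⁻ : ∀ c {i j} → j < threshold c i → j ≤ i ⊎ (j ≡ suc i × c i ≡ true)
<-threshold⁻ c {i} {j} lt with c i
... | false = inj₁ (s≤s⁻¹ lt)
... | true with ℕₚ.m≤n⇒m<n∨m≡n (s≤s⁻¹ lt)
...   | inj₁ j<1+i = inj₁ (s≤s⁻¹ j<1+i)
...   | inj₂ j≡1+i = inj₂ (j≡1+i , refl)

<-threshold⁺ : ∀ c {i j} → j ≤ i ⊎ (j ≡ suc i × c i ≡ true) → j < threshold c i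
<-threshold⁺ c {i} (inj₁ j≤i) = ℕₚ.≤-trans (s≤s j≤i) (ℕₚ.m≤n+m (suc i) (bit (c i)))
<-threshold⁺ c {i} (inj₂ (refl , ci)) rewrite ci = ℕₚ.≤-refl

-- (true , i) is to label the i-th maximal and (false , j) the j-th minimal vertex of the
-- inversion order, so that both chains increase in value as well as in position.
Interleaved : (ℕ → Bool) → Label m → Label m → Set
Interleaved c (false , j) (false , j′) = j <ᶠ j′
Interleaved c (true  , i) (true  , i′) = i <ᶠ i′
Interleaved c (false , j) (true  , i)  = toℕ j < threshold c (toℕ i)
Interleaved c (true  , i) (false , j)  = threshold c (toℕ i) ≤ toℕ j

interleaved-isStrictTotalOrder : ∀ c → IsStrictTotalOrder _≡_ (Interleaved {m} c)
interleaved-isStrictTotalOrder {m} c = isStrictTotalOrderᶜ record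
  { isEquivalence = isEquivalence
  ; trans = λ {x} {y} {z} → tr x y z
  ; compare = cmp
  }
  where

  tr : ∀ x y z → Interleaved {m} c x y → Interleaved c y z → Interleaved c x z
  tr (false , _) (false , _) (false , _) p q = ℕₚ.<-trans p q
  tr (false , _) (false , _) (true  , _) p q = ℕₚ.<-trans p q
  tr (false , _) (true  , _) (false , _) p q = ℕₚ.<-≤-trans p q
  tr (false , _) (true  , _) (true  , _) p q = ℕₚ.<-≤-trans p (threshold-mono c q)
  tr (true  , _) (false , _) (false , _) p q = ℕₚ.≤-trans p (ℕₚ.<⇒≤ q)
  -- Here `p` and `q` put the threshold of `i` strictly below that of `k`, which monotonicity allows
  -- only for `i < k`.
  tr (true  , i) (false , _) (true  , k) p q with <-cmp i k
  ... | tri< i<k _ _  = i<k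
  ... | tri≈ _ refl _ = contradiction (ℕₚ.≤-<-trans p q) (ℕₚ.<-irrefl refl)
  ... | tri> _ _ k<i  =
    contradiction (ℕₚ.≤-<-trans p q) (ℕₚ.≤⇒≯ (threshold-mono c k<i))
  tr (true  , _) (true  , _) (false , _) p q = ℕₚ.≤-trans (threshold-mono c p) q
  tr (true  , _) (true  , _) (true  , _) p q = ℕₚ.<-trans p q

  cmp : Trichotomous _≡_ (Interleaved {m} c)
  cmp (false , j) (false , j′) with <-cmp j j′
  ... | tri< lt ¬eq ¬gt = tri< lt (λ { refl → ¬eq refl }) ¬gt
  ... | tri≈ ¬lt refl ¬gt = tri≈ ¬lt refl ¬gt
  ... | tri> ¬lt ¬eq gt = tri> ¬lt (λ { refl → ¬eq refl }) gt
  cmp (true , i) (true , i′) with <-cmp i i′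
  ... | tri< lt ¬eq ¬gt = tri< lt (λ { refl → ¬eq refl }) ¬gt
  ... | tri≈ ¬lt refl ¬gt = tri≈ ¬lt refl ¬gt
  ... | tri> ¬lt ¬eq gt = tri> ¬lt (λ { refl → ¬eq refl }) gt
  cmp (false , j) (true , i) with toℕ j ℕ.<? threshold c (toℕ i)
  ... | yes lt = tri< lt (λ ()) (ℕₚ.<⇒≱ lt)
  ... | no ¬lt = tri> ¬lt (λ ()) (ℕₚ.≮⇒≥ ¬lt)
  cmp (true , i) (false , j) with toℕ j ℕ.<? threshold c (toℕ i)
  ... | yes lt = tri> (ℕₚ.<⇒≱ lt) (λ ()) lt
  ... | no ¬lt = tri< (ℕₚ.≮⇒≥ ¬lt) (λ ()) ¬lt

-- The bit at `i` is the kind of the link from `i` to `suc i`: `true` if it joins the maximal vertex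
-- at `i` to the minimal one at `suc i`, `false` if it joins the minimal one at `i` to the maximal
-- one at `suc i`.
alternating : Bool → ℕ → Bool
alternating b zero    = b
alternating b (suc i) = not (alternating b i)

-- An edge places its larger vertex earlier, so the chains trade roles by position. The bit at `i`
-- decides which of the two orders gets the extra crossing between `i` and `suc i`; since it is
-- negated for positions, exactly one of the two possible links becomes an edge.
ByValue ByPosition : Bool → Label m → Label m → Set
ByValue    b     = Interleaved (alternating b)
ByPosition b x y = Interleaved (not ∘ alternating b) (opposite x) (opposite y)

byValue-isStrictTotalOrder : ∀ b → IsStrictTotalOrder _≡_ (ByValue {m} b)
byValue-isStrictTotalOrder b = interleaved-isStrictTotalOrder (alternating b)

byPosition-isStrictTotalOrder : ∀ b → IsStrictTotalOrder _≡_ (ByPosition {m} b)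
byPosition-isStrictTotalOrder {m} b = isStrictTotalOrderᶜ record
  { isEquivalence = isEquivalence
  ; trans   = I.trans
  ; compare = cmp
  }
  where
  module I = IsStrictTotalOrder (interleaved-isStrictTotalOrder {m} (not ∘ alternating b))

  opposite-injective : ∀ {x y : Label m} → opposite x ≡ opposite y → x ≡ y
  opposite-injective {false , _} {false , _} refl = refl
  opposite-injective {true  , _} {true  , _} refl = refl

  cmp : Trichotomous _≡_ (ByPosition {m} b)
  cmp x y with I.compare (opposite x) (opposite y)
  ... | tri< lt ¬eq ¬gt = tri< lt (¬eq ∘ cong opposite) ¬gt
  ... | tri≈ ¬lt eq ¬gt = tri≈ ¬lt (opposite-injective eq) ¬gt
  ... | tri> ¬lt ¬eq gt = tri> ¬lt (¬eq ∘ cong opposite) gt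

module ValueOrder {m} b    = FiniteOrder (byValue-isStrictTotalOrder {m} b)
module PositionOrder {m} b = FiniteOrder (byPosition-isStrictTotalOrder {m} b)

-- Both label orders are linear, so the monotone bijections also reflect them. As embeddings of
-- finite orders they are unique, and together they pin down `π`.
record Layout (m : ℕ) (b : Bool) (π : Permutation′ n) : Set where
  field
    label         : Label m ↔ Fin n
    value-mono    : ∀ {x y} → ByValue b x y → Inverse.to label x <ᶠ Inverse.to label y
    position-mono : ∀ {x y} → ByPosition b x y →
                    π ⟨$⟩ˡ Inverse.to label x <ᶠ π ⟨$⟩ˡ Inverse.to label y

  open Inverse label public using (to; from; strictlyInverseˡ; strictlyInverseʳ)

  positions : Label m ↔ Fin n
  positions = ↔-sym π ↔-∘ label

-- Rank the labels in both orders; the permutation takes the position rank of a label to its value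
-- rank.
layout-exists : ∀ m → n ≡ 2 * m → ∀ b → ∃ λ (π : Permutation′ n) → Layout m b π
layout-exists m refl b =
  let φ     = ↔-sym ((2↔Bool ×-↔ ↔-id _) ↔-∘ *↔×)
      V , V-mono = ValueOrder.embedding b φ
      P , P-mono = PositionOrder.embedding b φ
  in V ↔-∘ ↔-sym P , record
    { label = V
    ; value-mono = V-mono
    ; position-mono = λ {x} {y} x≺y → subst₂ _<ᶠ_
        (cong (Inverse.to P) (sym (Inverse.strictlyInverseʳ V x)))
        (cong (Inverse.to P) (sym (Inverse.strictlyInverseʳ V y)))
        (P-mono x≺y)
    }

layout-unique : ∀ {b} {π σ : Permutation′ n} → Layout m b π → Layout m b σ → SamePerm π σ
layout-unique {b = b} {π} {σ} Lπ Lσ p = trans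
  (sym (inverseʳ σ)) (cong (σ ⟨$⟩ʳ_) (trans (sym (same-position (π ⟨$⟩ʳ p))) (inverseˡ π)))
  where
  open Layout
  same-position : ∀ v → π ⟨$⟩ˡ v ≡ σ ⟨$⟩ˡ v
  same-position v = trans (cong (π ⟨$⟩ˡ_) (sym (strictlyInverseˡ Lπ v)))
    (trans (PositionOrder.embedding-unique b (positions Lπ) (positions Lσ)
             (position-mono Lπ) (position-mono Lσ) x)
           (cong (σ ⟨$⟩ˡ_) (trans
             (sym (ValueOrder.embedding-unique b (label Lπ) (label Lσ) (value-mono Lπ) (value-mono Lσ) x))
             (strictlyInverseˡ Lπ v))))
    where x = from Lπ v

Consecutive : Fin m → Fin m → Set
Consecutive i j = suc (toℕ i) ≡ toℕ j ⊎ suc (toℕ j) ≡ toℕ i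

-- The graph of a layout is a comb

module LayoutGraph {b} {π : Permutation′ n} (L : Layout m b π) where
  open Layout L

  c : Fin m → Bool
  c i = alternating b (toℕ i)

  consecutive⇒not : ∀ {i j} → Consecutive i j → c j ≡ not (c i)
  consecutive⇒not (inj₁ 1+i≡j) = cong (alternating b) (sym 1+i≡j)
  consecutive⇒not (inj₂ 1+j≡i) =
    trans (sym (not-involutive _)) (cong not (cong (alternating b) 1+j≡i))

  below⁺ : ∀ {x y} → ByValue b x y → ByPosition b y x → Adj π (to x) (to y)
  below⁺ v p = inj₁ (value-mono v , position-mono p)

  below⁻ : ∀ {x y} → to x <ᶠ to y × π ⟨$⟩ˡ to y <ᶠ π ⟨$⟩ˡ to x → ByValue b x y × ByPosition b y x
  below⁻ (v , p) = ValueOrder.reflects b label value-mono v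
                 , PositionOrder.reflects b positions position-mono p

  same-side : ∀ s {i j} → ¬ Adj π (to (s , i)) (to (s , j))
  same-side false (inj₁ lt) = let v , p = below⁻ lt in ℕₚ.<-asym v p
  same-side false (inj₂ lt) = let v , p = below⁻ lt in ℕₚ.<-asym v p
  same-side true  (inj₁ lt) = let v , p = below⁻ lt in ℕₚ.<-asym v p
  same-side true  (inj₂ lt) = let v , p = below⁻ lt in ℕₚ.<-asym v p

  -- This turns out to be adjacency of `(s , i)` and `(not s , j)`. Because the bits alternate, one
  -- condition on `c i` covers both the link to the next index and the link to the previous one.
  Near : Bool → Fin m → Fin m → Set
  Near s i j = i ≡ j ⊎ (Consecutive i j × c i ≡ s)

  Near-sym : ∀ {s i j} → Near s i j → Near (not s) j i
  Near-sym (inj₁ i≡j)         = inj₁ (sym i≡j)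
  Near-sym (inj₂ (con , eq)) = inj₂ (swap con , trans (consecutive⇒not con) (cong not eq))

  upper-lower⁻ : ∀ {i j} → Adj π (to (true , i)) (to (false , j)) → Near true i j
  -- With the maximal vertex smaller in value, the value comparison gives `i < j` and the position
  -- comparison gives `j < i`.
  upper-lower⁻ {i} {j} (inj₁ lt) =
    let v , p = below⁻ lt in contradiction
      (ℕₚ.<-trans (ℕₚ.<-≤-trans (<-threshold⁺ (alternating b) (inj₁ ℕₚ.≤-refl)) v)
                  (ℕₚ.<-≤-trans (<-threshold⁺ (not ∘ alternating b) (inj₁ ℕₚ.≤-refl)) p))
      (ℕₚ.<-irrefl refl)
  upper-lower⁻ {i} {j} (inj₂ lt)
    with v , p ← below⁻ lt
    with <-threshold⁻ (alternating b) v | <-threshold⁻ (not ∘ alternating b) p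
  ... | inj₁ j≤i          | inj₁ i≤j          = inj₁ (toℕ-injective (ℕₚ.≤-antisym i≤j j≤i))
  ... | inj₂ (j≡1+i , ci) | _                 = inj₂ (inj₁ (sym j≡1+i) , ci)
  ... | inj₁ _            | inj₂ (i≡1+j , cj) =
    inj₂ (inj₂ (sym i≡1+j) , trans (cong (alternating b) i≡1+j) cj)

  upper-lower⁺ : ∀ {i j} → Near true i j → Adj π (to (true , i)) (to (false , j))
  upper-lower⁺ {i} {j} near = Adj-sym π (below⁺ {false , j} {true , i}
    (<-threshold⁺ (alternating b) (value near))
    (<-threshold⁺ (not ∘ alternating b) (position near)))
    where
    value : Near true i j → toℕ j ≤ toℕ i ⊎ (toℕ j ≡ suc (toℕ i) × c i ≡ true)
    value (inj₁ refl)              = inj₁ ℕₚ.≤-refl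
    value (inj₂ (inj₁ 1+i≡j , ci)) = inj₂ (sym 1+i≡j , ci)
    value (inj₂ (inj₂ 1+j≡i , ci)) = inj₁ (ℕₚ.≤-trans (ℕₚ.n≤1+n _) (ℕₚ.≤-reflexive 1+j≡i))

    position : Near true i j → toℕ i ≤ toℕ j ⊎ (toℕ i ≡ suc (toℕ j) × not (c j) ≡ true)
    position (inj₁ refl)              = inj₁ ℕₚ.≤-refl
    position (inj₂ (inj₁ 1+i≡j , ci)) = inj₁ (ℕₚ.≤-trans (ℕₚ.n≤1+n _) (ℕₚ.≤-reflexive 1+i≡j))
    position (inj₂ (inj₂ 1+j≡i , ci)) = inj₂ (sym 1+j≡i , trans (cong (alternating b) 1+j≡i) ci)

  adjacent⁺ : ∀ s {i j} → Near s i j → Adj π (to (s , i)) (to (not s , j))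
  adjacent⁺ true  near = upper-lower⁺ near
  adjacent⁺ false near = Adj-sym π (upper-lower⁺ (Near-sym near))

  adjacent⁻ : ∀ s s′ {i j} → Adj π (to (s , i)) (to (s′ , j)) → s′ ≡ not s × Near s i j
  adjacent⁻ false false adj = contradiction adj (same-side false)
  adjacent⁻ true  true  adj = contradiction adj (same-side true)
  adjacent⁻ true  false adj = refl , upper-lower⁻ adj
  adjacent⁻ false true  adj = refl , Near-sym (upper-lower⁻ (Adj-sym π adj))

  -- By `Near`, of the two vertices at index `i` only the one on side `c i` has neighbours at other
  -- indices. The path therefore zigzags between the two chains.
  spine tooth : Fin m → Label m
  spine i = c i , i
  tooth i = not (c i) , i

  x≢not-x : ∀ {x} → x ≢ not x
  x≢not-x {false} ()
  x≢not-x {true} ()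

  spine-tooth⁻ : ∀ {i j} → Adj π (to (spine i)) (to (tooth j)) → i ≡ j
  spine-tooth⁻ adj with adjacent⁻ _ _ adj
  ... | _  , inj₁ i≡j       = i≡j
  ... | eq , inj₂ (con , _) =
    contradiction (trans (consecutive⇒not con) (sym eq)) x≢not-x

  isComb : IsComb π
  isComb = m , label ↔-∘ mk↔ₛ′ arrange sort arrange-sort sort-arrange
         , (λ i j → mk⇔ (path⁻ i j) (path⁺ i j)) , teeth-independent
         , (λ i → i , matched i , λ j adj → sym (spine-tooth⁻ adj))
         , (λ j → j , matched j , λ i adj → spine-tooth⁻ adj)
    where
    arrange : Fin m ⊎ Fin m → Label m
    arrange = [ spine , tooth ]′

    sort : Label m → Fin m ⊎ Fin m
    sort (s , i) with s ≟ᵇ c i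
    ... | yes _ = inj₁ i
    ... | no  _ = inj₂ i

    arrange-sort : ∀ x → arrange (sort x) ≡ x
    arrange-sort (s , i) with s ≟ᵇ c i
    ... | yes s≡ = cong (_, i) (sym s≡)
    ... | no  s≢ = cong (_, i) (sym (¬-not s≢))

    sort-arrange : ∀ x → sort (arrange x) ≡ x
    sort-arrange (inj₁ i) with c i ≟ᵇ c i
    ... | yes _  = refl
    ... | no  ≢  = contradiction refl ≢
    sort-arrange (inj₂ i) with not (c i) ≟ᵇ c i
    ... | yes eq = contradiction (sym eq) x≢not-x
    ... | no  _  = refl

    path⁻ : ∀ i j → Adj π (to (spine i)) (to (spine j)) → Consecutive i j
    path⁻ i j adj with adjacent⁻ _ _ adj
    ... | eq , inj₁ refl      = contradiction eq x≢not-x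
    ... | _  , inj₂ (con , _) = con

    path⁺ : ∀ i j → Consecutive i j → Adj π (to (spine i)) (to (spine j))
    path⁺ i j con = subst (λ s → Adj π (to (spine i)) (to (s , j))) (sym (consecutive⇒not con))
      (adjacent⁺ (c i) (inj₂ (con , refl)))

    teeth-independent : ∀ i j → ¬ Adj π (to (tooth i)) (to (tooth j))
    teeth-independent i j adj with adjacent⁻ _ _ adj
    ... | eq , inj₁ refl     = contradiction eq x≢not-x
    ... | _  , inj₂ (_ , eq) = contradiction eq x≢not-x

    matched : ∀ i → Adj π (to (spine i)) (to (tooth i))
    matched i = adjacent⁺ (c i) (inj₁ refl)

-- In both layouts (true , 0) comes first by position and (false , 0) first by value,
-- but only for b = true is (true , 0) adjacent to something other than (false , 0).
layouts-differ : {π σ : Permutation′ n} → 1 < m → Layout m true π → Layout m false σ → ¬ SamePerm π σ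
layouts-differ {n} {suc (suc m)} {π} {σ} (s≤s (s≤s z≤n)) Lπ Lσ same = absurd
  where
  module P = Layout Lπ
  module S = Layout Lσ
  open LayoutGraph using (adjacent⁺; adjacent⁻)

  same-position : ∀ v → π ⟨$⟩ˡ v ≡ σ ⟨$⟩ˡ v
  same-position v = trans (sym (inverseˡ σ))
    (cong (σ ⟨$⟩ˡ_) (trans (sym (same (π ⟨$⟩ˡ v))) (inverseʳ π)))

  adj-transfer : ∀ {u v} → Adj π u v → Adj σ u v
  adj-transfer {u} {v} = subst₂ (λ p q → (u <ᶠ v × q <ᶠ p) ⊎ (v <ᶠ u × p <ᶠ q)) (same-position u) (same-position v)

  chain-minimum : ∀ c (y : Label (suc (suc m))) → ¬ Interleaved c y (false , zero)
  chain-minimum c (true , i) lt with () ← ℕₚ.≤-trans (<-threshold⁺ c {toℕ i} (inj₁ z≤n)) lt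

  value₀ : P.to (false , zero) ≡ S.to (false , zero)
  value₀ = toℕ-injective (trans
    (ValueOrder.minimum↦0 true P.label P.value-mono (chain-minimum _))
    (sym (ValueOrder.minimum↦0 false S.label S.value-mono (chain-minimum _))))

  position₀ : P.to (true , zero) ≡ S.to (true , zero)
  position₀ = ↔-injective (↔-sym σ) (toℕ-injective (trans
    (trans (cong toℕ (sym (same-position _)))
      (PositionOrder.minimum↦0 true P.positions P.position-mono (chain-minimum _ ∘ opposite)))
    (sym (PositionOrder.minimum↦0 false S.positions S.position-mono (chain-minimum _ ∘ opposite)))))

  adj : Adj σ (S.to (true , zero)) (S.to (S.from (P.to (false , suc zero))))
  adj = subst₂ (Adj σ) position₀ (sym (S.strictlyInverseˡ _))
          (adj-transfer (adjacent⁺ Lπ true (inj₂ (inj₁ refl , refl))))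

  only-neighbour : ∀ y → Adj σ (S.to (true , zero)) (S.to y) → y ≡ (false , zero)
  only-neighbour (s , j) adj with adjacent⁻ Lσ true s adj
  -- The other case of `Near` would need `alternating false 0` to be `true`.
  ... | refl , inj₁ refl = refl

  absurd : ⊥
  absurd with () ← ↔-injective P.label {false , suc zero} {false , zero} (trans
    (sym (S.strictlyInverseˡ _)) (trans (cong S.to (only-neighbour _ adj)) (sym value₀)))

-- Leaving out index `k` by `punchIn` keeps at most `m` minus one of the chosen vertices. This is
-- the source of every contradiction with the domination number below.
dominating-omit : (π : Permutation′ n) (c : Fin m → Fin n) (k : Fin m) →
                  (∀ v → ∃ λ a → a ≢ k × (c a ≡ v ⊎ Adj π (c a) v)) →
                  ∃ λ (D : Subset n) → Dominating π D × ∣ D ∣ < m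
dominating-omit {m = suc m} π c k dominated =
  image (c ∘ punchIn k) , dominating , s≤s (∣image∣≤ (c ∘ punchIn k))
  where
  kept : ∀ {a} → a ≢ k → c a ∈ image (c ∘ punchIn k)
  kept a≢k = subst (λ a → c a ∈ image (c ∘ punchIn k)) (punchIn-punchOut (a≢k ∘ sym))
               (∈-image (c ∘ punchIn k) (punchOut (a≢k ∘ sym)))

  dominating : Dominating π (image (c ∘ punchIn k))
  dominating v with dominated v
  ... | a , a≢k , inj₁ refl = inj₁ (kept a≢k)
  ... | a , a≢k , inj₂ adj  = inj₂ (c a , kept a≢k , adj)

another : 2 ≤ n → ∀ (v : Fin n) → ∃ λ w → v ≢ w
another (s≤s (s≤s _)) zero    = suc zero , λ ()
another (s≤s (s≤s _)) (suc _) = zero , λ ()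

previous : ∀ (i : Fin m) → 0 < toℕ i → ∃ λ (h : Fin m) → suc (toℕ h) ≡ toℕ i
previous (suc i) _ = inject₁ i , cong suc (toℕ-inject₁ i)

next : ∀ (i : Fin m) → suc (toℕ i) < m → ∃ λ (k : Fin m) → suc (toℕ i) ≡ toℕ k
next i lt = fromℕ< lt , sym (toℕ-fromℕ< lt)

-- Permutations with maximal domination number

module Extremal {n m : ℕ} (n≡2m : n ≡ 2 * m) (6≤n : 6 ≤ n) (π : Permutation′ n)
                (connected : Connected π) (γ : ∀ D → Dominating π D → m ≤ ∣ D ∣) where

  -- The inversion order and its extremal vertices

  pos : Fin n → Fin n
  pos = π ⟨$⟩ˡ_

  _⊏_ : Fin n → Fin n → Set
  u ⊏ v = u <ᶠ v × pos v <ᶠ pos u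

  _⊏?_ : Decidable _⊏_
  u ⊏? v = (u <? v) ×-dec (pos v <? pos u)

  ⊏-trans : Transitive _⊏_
  ⊏-trans (p , q) (p′ , q′) = ℕₚ.<-trans p p′ , ℕₚ.<-trans q′ q

  ⊏-wellFounded : WellFounded _⊏_
  ⊏-wellFounded = Subrelation.wellFounded proj₁ <-wellFounded

  ⊐-wellFounded : WellFounded (flip _⊏_)
  ⊐-wellFounded = Subrelation.wellFounded proj₁ >-wellFounded

  IsMin IsMax : Fin n → Set
  IsMin v = ¬ ∃ λ u → u ⊏ v
  IsMax v = ¬ ∃ λ u → v ⊏ u

  minimum-below : ∀ v → IsMin v ⊎ ∃ λ u → u ⊏ v × IsMin u
  minimum-below = minimal-below _⊏?_ ⊏-trans ⊏-wellFounded

  maximum-above : ∀ v → IsMax v ⊎ ∃ λ u → v ⊏ u × IsMax u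
  maximum-above = minimal-below (flip _⊏?_) (flip ⊏-trans) ⊐-wellFounded

  -- Connectedness and a second vertex give `v` a neighbour, which lies above or below it.
  not-isolated : ∀ {v} → IsMin v → ¬ IsMax v
  not-isolated {v} min max
    with w , v≢w ← another (ℕₚ.≤-trans (s≤s (s≤s z≤n)) 6≤n) v
    with walk⇒neighbour (connected v w) v≢w
  ... | u , inj₁ v⊏u = max (u , v⊏u)
  ... | u , inj₂ u⊏v = min (u , u⊏v)

  min? : ∀ v → Dec (IsMin v)
  min? v = ¬? (any? (_⊏? v))

  max? : ∀ v → Dec (IsMax v)
  max? v = ¬? (any? (v ⊏?_))

  Mins Maxs : Subset n
  Mins = comprehension min?
  Maxs = comprehension max?

  Mins-dominating : Dominating π Mins
  Mins-dominating v with minimum-below v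
  ... | inj₁ min             = inj₁ (∈-comprehension⁺ min? min)
  ... | inj₂ (u , u⊏v , min) = inj₂ (u , ∈-comprehension⁺ min? min , inj₁ u⊏v)

  Maxs-dominating : Dominating π Maxs
  Maxs-dominating v with maximum-above v
  ... | inj₁ max             = inj₁ (∈-comprehension⁺ max? max)
  ... | inj₂ (u , v⊏u , max) = inj₂ (u , ∈-comprehension⁺ max? max , inj₂ v⊏u)

  Mins⊆∁Maxs : Mins ⊆ ∁ Maxs
  Mins⊆∁Maxs v∈ = x∉p⇒x∈∁p λ v∈′ →
    not-isolated (∈-comprehension⁻ min? v∈) (∈-comprehension⁻ max? v∈′)

  ∣Maxs∣+∣∁Maxs∣≡m+m : ∣ Maxs ∣ + ∣ ∁ Maxs ∣ ≡ m + m
  ∣Maxs∣+∣∁Maxs∣≡m+m = trans (cong (∣ Maxs ∣ +_) (∣∁p∣≡n∸∣p∣ Maxs))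
    (trans (ℕₚ.m+[n∸m]≡n (∣p∣≤n Maxs)) (trans n≡2m (cong (m +_) (ℕₚ.+-identityʳ m))))

  ∣∁Maxs∣≤m : ∣ ∁ Maxs ∣ ≤ m
  ∣∁Maxs∣≤m = ℕₚ.+-cancelˡ-≤ m _ _ (ℕₚ.≤-trans
    (ℕₚ.+-monoˡ-≤ _ (γ Maxs Maxs-dominating)) (ℕₚ.≤-reflexive ∣Maxs∣+∣∁Maxs∣≡m+m))

  m≤∣Mins∣ : m ≤ ∣ Mins ∣
  m≤∣Mins∣ = γ Mins Mins-dominating

  ∣Mins∣≡m : ∣ Mins ∣ ≡ m
  ∣Mins∣≡m = ℕₚ.≤-antisym (ℕₚ.≤-trans (p⊆q⇒∣p∣≤∣q∣ Mins⊆∁Maxs) ∣∁Maxs∣≤m) m≤∣Mins∣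

  ∣Maxs∣≡m : ∣ Maxs ∣ ≡ m
  ∣Maxs∣≡m = ℕₚ.≤-antisym
    (ℕₚ.+-cancelʳ-≤ m _ _ (ℕₚ.≤-trans
      (ℕₚ.+-monoʳ-≤ ∣ Maxs ∣ (ℕₚ.≤-trans m≤∣Mins∣ (p⊆q⇒∣p∣≤∣q∣ Mins⊆∁Maxs)))
      (ℕₚ.≤-reflexive ∣Maxs∣+∣∁Maxs∣≡m+m)))
    (γ Maxs Maxs-dominating)

  -- A vertex in neither set would make `Mins` a proper subset of `∁ Maxs`, which has at most `m`
  -- elements.
  Maxs∪Mins : ∀ {v} → v ∉ Maxs → v ∈ Mins
  Maxs∪Mins {v} v∉ with v ∈? Mins
  ... | yes v∈ = v∈
  ... | no v∉′ = contradiction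
    (ℕₚ.<-≤-trans (p⊂q⇒∣p∣<∣q∣ (Mins⊆∁Maxs , v , x∉p⇒x∈∁p v∉ , v∉′)) (ℕₚ.≤-trans ∣∁Maxs∣≤m m≤∣Mins∣))
    (ℕₚ.<-irrefl refl)

  abstract
    Maxs-enumeration : Enumeration Maxs m
    Maxs-enumeration = subst (Enumeration Maxs) ∣Maxs∣≡m (enumerate Maxs)

    Mins-enumeration : Enumeration Mins m
    Mins-enumeration = subst (Enumeration Mins) ∣Mins∣≡m (enumerate Mins)

  -- The two increasing chains and the edges between them

  module U = Enumeration Maxs-enumeration
  module D = Enumeration Mins-enumeration

  u d : Fin m → Fin n
  u = U.at
  d = D.at

  u-max : ∀ i → IsMax (u i)
  u-max i = ∈-comprehension⁻ max? (U.at∈p i)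

  d-min : ∀ i → IsMin (d i)
  d-min i = ∈-comprehension⁻ min? (D.at∈p i)

  u≢d : ∀ {i j} → u i ≢ d j
  u≢d {i} {j} eq = not-isolated (d-min j) (subst IsMax eq (u-max i))

  pos-injective : Injective _≡_ _≡_ pos
  pos-injective = ↔-injective (↔-sym π)

  pos-mono : ∀ {v w} → v <ᶠ w → ¬ (v ⊏ w) → pos v <ᶠ pos w
  pos-mono {v} {w} v<w v⋢w with <-cmp (pos v) (pos w)
  ... | tri< lt _ _ = lt
  ... | tri≈ _ eq _ = contradiction (cong toℕ (pos-injective eq)) (ℕₚ.<⇒≢ v<w)
  ... | tri> _ _ gt = contradiction (v<w , gt) v⋢w

  pos-u-mono : ∀ {i j} → i <ᶠ j → pos (u i) <ᶠ pos (u j)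
  pos-u-mono {i} {j} i<j = pos-mono (U.mono i<j) (λ p → u-max i (u j , p))

  pos-d-mono : ∀ {i j} → i <ᶠ j → pos (d i) <ᶠ pos (d j)
  pos-d-mono {i} {j} i<j = pos-mono (D.mono i<j) (λ p → d-min j (d i , p))

  weaken : {f : Fin m → Fin n} → (∀ {i j} → i <ᶠ j → f i <ᶠ f j) → ∀ {i j} → i ≤ᶠ j → f i ≤ᶠ f j
  weaken f-mono i≤j with ℕₚ.m≤n⇒m<n∨m≡n i≤j
  ... | inj₁ i<j = ℕₚ.<⇒≤ (f-mono i<j)
  ... | inj₂ i≡j with refl ← toℕ-injective i≡j = ℕₚ.≤-refl

  vertex : Label m → Fin n
  vertex (true  , i) = u i
  vertex (false , i) = d i

  abstract
    locate : ∀ v → ∃ λ x → vertex x ≡ v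
    locate v with v ∈? Maxs
    ... | yes v∈ = let i , eq = U.index v∈ in (true , i) , eq
    ... | no v∉  = let i , eq = D.index (Maxs∪Mins v∉) in (false , i) , eq

  vertex-injective : ∀ x y → vertex x ≡ vertex y → x ≡ y
  vertex-injective (true  , i) (true  , j) eq = cong (true ,_) (U.at-injective eq)
  vertex-injective (true  , i) (false , j) eq = contradiction eq u≢d
  vertex-injective (false , i) (true  , j) eq = contradiction (sym eq) u≢d
  vertex-injective (false , i) (false , j) eq = cong (false ,_) (D.at-injective eq)

  vertices : Label m ↔ Fin n
  vertices = mk↔ₛ′ vertex (proj₁ ∘ locate) (proj₂ ∘ locate)
               (λ x → vertex-injective _ x (proj₂ (locate (vertex x))))

  -- The flag is the side of the first index, so that one argument serves both kinds of link while
  -- the value and position comparisons stay accessible.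
  Edge : Bool → Fin m → Fin m → Set
  Edge true  i j = d j ⊏ u i
  Edge false i j = d i ⊏ u j

  edge⇒adj : ∀ s {i j} → Edge s i j → Adj π (vertex (s , i)) (vertex (not s , j))
  edge⇒adj true  = inj₂
  edge⇒adj false = inj₁

  Edge-sym : ∀ s {i j} → Edge s i j → Edge (not s) j i
  Edge-sym true  = id
  Edge-sym false = id

  Edge-sym⁻ : ∀ s {i j} → Edge (not s) i j → Edge s j i
  Edge-sym⁻ true  = id
  Edge-sym⁻ false = id

  adj⇒edge : ∀ s s′ {i j} → Adj π (vertex (s , i)) (vertex (s′ , j)) → Edge s i j
  adj⇒edge true  _     (inj₁ lt) = contradiction (_ , lt) (u-max _)
  adj⇒edge true  true  (inj₂ lt) = contradiction (_ , lt) (u-max _)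
  adj⇒edge true  false (inj₂ lt) = lt
  adj⇒edge false true  (inj₁ lt) = lt
  adj⇒edge false false (inj₁ lt) = contradiction (_ , lt) (d-min _)
  adj⇒edge false _     (inj₂ lt) = contradiction (_ , lt) (d-min _)

  has-edge : ∀ s i → ∃ λ j → Edge s i j
  has-edge true i with minimum-below (u i)
  ... | inj₁ min = contradiction (u-max i) (not-isolated min)
  ... | inj₂ (v , v⊏u , min) =
    let j , dj≡v = D.index (∈-comprehension⁺ min? min) in j , subst (_⊏ u i) (sym dj≡v) v⊏u
  has-edge false i with maximum-above (d i)
  ... | inj₁ max = contradiction max (not-isolated (d-min i))
  ... | inj₂ (v , d⊏v , max) =
    let j , uj≡v = U.index (∈-comprehension⁺ max? max) in j , subst (d i ⊏_) (sym uj≡v) d⊏v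

  -- No vertex of index k is used, so covering every x takes only m − 1 vertices.
  Covered : Bool → Fin m → Label m → Set
  Covered s k x = ∃ λ a →
      (a <ᶠ k × (x ≡ (s , a) ⊎ Adj π (vertex (s , a)) (vertex x)))
    ⊎ (k <ᶠ a × (x ≡ (not s , a) ⊎ Adj π (vertex (not s , a)) (vertex x)))

  not-covered : ∀ s k → ¬ (∀ x → Covered s k x)
  not-covered s k covered =
    let D , dom , small = dominating-omit π (λ a → vertex (side a , a)) k dominated
    in contradiction (γ D dom) (ℕₚ.<⇒≱ small)
    where
    -- At `k` itself the value `not s` is a mere default, because `dominating-omit` drops that
    -- index.
    side : Fin m → Bool
    side a with a <? k
    ... | yes _ = s
    ... | no  _ = not s

    side-< : ∀ {a} → a <ᶠ k → side a ≡ s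
    side-< {a} a<k with a <? k
    ... | yes _   = refl
    ... | no a≮k = contradiction a<k a≮k

    side-> : ∀ {a} → k <ᶠ a → side a ≡ not s
    side-> {a} k<a with a <? k
    ... | yes a<k = contradiction a<k (ℕₚ.<-asym k<a)
    ... | no _    = refl

    reach : ∀ {t a x} → side a ≡ t → x ≡ (t , a) ⊎ Adj π (vertex (t , a)) (vertex x) →
            vertex (side a , a) ≡ vertex x ⊎ Adj π (vertex (side a , a)) (vertex x)
    reach refl (inj₁ refl) = inj₁ refl
    reach refl (inj₂ adj)  = inj₂ adj

    dominated : ∀ v → ∃ λ a → a ≢ k × (vertex (side a , a) ≡ v ⊎ Adj π (vertex (side a , a)) v)
    dominated v with x , refl ← locate v with covered x
    ... | a , inj₁ (a<k , r) = a , (λ { refl → ℕₚ.<-irrefl refl a<k }) , reach (side-< a<k) r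
    ... | a , inj₂ (k<a , r) = a , (λ { refl → ℕₚ.<-irrefl refl k<a }) , reach (side-> k<a) r

  by-side : ∀ s {P : Label m → Set} → (∀ a → P (s , a)) → (∀ a → P (not s , a)) → ∀ x → P x
  by-side true  p q (true  , a) = p a
  by-side true  p q (false , a) = q a
  by-side false p q (false , a) = p a
  by-side false p q (true  , a) = q a

  -- Choose side `s` below `k` and side `not s` above. If no edge of this form existed, every
  -- neighbour of an unchosen vertex would be chosen, and by `has-edge` there is one; so the choice
  -- would dominate.
  not-separated : ∀ s k → ¬ (∀ {a j} → a ≤ᶠ k → k ≤ᶠ j → ¬ Edge (not s) a j)
  not-separated s k separated = not-covered s k (by-side s same other)
    where
    same : ∀ a → Covered s k (s , a)
    same a with a <? k | has-edge s a
    ... | yes a<k | _     = a , inj₁ (a<k , inj₁ refl)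
    ... | no a≮k | j , e with k <? j
    ...   | yes k<j = j , inj₂ (k<j , inj₂ (Adj-sym π (edge⇒adj s e)))
    ...   | no k≮j = contradiction (Edge-sym s e) (separated (ℕₚ.≮⇒≥ k≮j) (ℕₚ.≮⇒≥ a≮k))

    other : ∀ a → Covered s k (not s , a)
    other a with k <? a | has-edge (not s) a
    ... | yes k<a | _     = a , inj₂ (k<a , inj₁ refl)
    ... | no k≮a | j , e with j <? k
    ...   | yes j<k = j , inj₁ (j<k , inj₂ (edge⇒adj s (Edge-sym⁻ s e)))
    ...   | no j≮k = contradiction e (separated (ℕₚ.≮⇒≥ k≮a) (ℕₚ.≮⇒≥ j≮k))

  -- If `u i` were below `d i` in value, monotonicity of the chains would put `u a` below `d j` for
  -- all `a ≤ i ≤ j`, contrary to `not-separated`. The next lemma repeats this for positions with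
  -- the sides exchanged.
  d<u : ∀ i → d i <ᶠ u i
  d<u i with <-cmp (d i) (u i)
  ... | tri< lt _ _ = lt
  ... | tri≈ _ eq _ = contradiction (sym eq) u≢d
  ... | tri> _ _ gt = contradiction
    (λ {a} {j} a≤i i≤j e → ℕₚ.<-irrefl refl (ℕₚ.<-≤-trans (proj₁ e)
       (ℕₚ.≤-trans (weaken U.mono a≤i) (ℕₚ.≤-trans (ℕₚ.<⇒≤ gt) (weaken D.mono i≤j)))))
    (not-separated false i)

  pos-u<pos-d : ∀ i → pos (u i) <ᶠ pos (d i)
  pos-u<pos-d i with <-cmp (pos (u i)) (pos (d i))
  ... | tri< lt _ _ = lt
  ... | tri≈ _ eq _ = contradiction (pos-injective eq) u≢d
  ... | tri> _ _ gt = contradiction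
    (λ {a} {j} a≤i i≤j e → ℕₚ.<-irrefl refl (ℕₚ.<-≤-trans (proj₂ e)
       (ℕₚ.≤-trans (weaken pos-d-mono a≤i) (ℕₚ.≤-trans (ℕₚ.<⇒≤ gt) (weaken pos-u-mono i≤j)))))
    (not-separated true i)

  d<u-≤ : ∀ {i j} → j ≤ᶠ i → d j <ᶠ u i
  d<u-≤ {i} j≤i = ℕₚ.≤-<-trans (weaken D.mono j≤i) (d<u i)

  pos-u<pos-d-≤ : ∀ {i j} → i ≤ᶠ j → pos (u i) <ᶠ pos (d j)
  pos-u<pos-d-≤ {i} i≤j = ℕₚ.<-≤-trans (pos-u<pos-d i) (weaken pos-d-mono i≤j)

  Edge-refl : ∀ s i → Edge s i i
  Edge-refl true  i = d<u i , pos-u<pos-d i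
  Edge-refl false i = d<u i , pos-u<pos-d i

  -- One of the two comparisons is squeezed along the chains; the other holds for all `i < j`, by
  -- `pos-u<pos-d-≤` or `d<u-≤`.
  Edge-narrow : ∀ s {a b i j} → a ≤ᶠ i → i <ᶠ j → j ≤ᶠ b → Edge s a b → Edge s i j
  Edge-narrow true a≤i i<j j≤b (v , p) =
      ℕₚ.≤-<-trans (weaken D.mono j≤b) (ℕₚ.<-≤-trans v (weaken U.mono a≤i))
    , pos-u<pos-d-≤ (ℕₚ.<⇒≤ i<j)
  Edge-narrow false a≤i i<j j≤b (v , p) =
      d<u-≤ (ℕₚ.<⇒≤ i<j)
    , ℕₚ.≤-<-trans (weaken pos-u-mono j≤b) (ℕₚ.<-≤-trans p (weaken pos-d-mono a≤i))

  -- With side `s` chosen below `j` and `not s` above, the two vertices of the omitted index `j` are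
  -- dominated from `i` and `k`, and every other unchosen vertex by its partner of the same index.
  no-two-edges : ∀ s {i j k} → i <ᶠ j → j <ᶠ k → Edge s i j → ¬ Edge s j k
  no-two-edges s {i} {j} {k} i<j j<k ij jk = not-covered s j (by-side s same other)
    where
    same : ∀ a → Covered s j (s , a)
    same a with <-cmp a j
    ... | tri< a<j _ _  = a , inj₁ (a<j , inj₁ refl)
    ... | tri≈ _ refl _ = k , inj₂ (j<k , inj₂ (Adj-sym π (edge⇒adj s jk)))
    ... | tri> _ _ j<a  = a , inj₂ (j<a , inj₂ (Adj-sym π (edge⇒adj s (Edge-refl s a))))

    other : ∀ a → Covered s j (not s , a)
    other a with <-cmp a j
    ... | tri< a<j _ _  = a , inj₁ (a<j , inj₂ (edge⇒adj s (Edge-refl s a)))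
    ... | tri≈ _ refl _ = i , inj₁ (i<j , inj₂ (edge⇒adj s ij))
    ... | tri> _ _ j<a  = a , inj₂ (j<a , inj₁ refl)

  -- Links between consecutive indices

  index-of : Fin n → Fin m
  index-of v = proj₂ (proj₁ (locate v))

  index-of-vertex : ∀ x → index-of (vertex x) ≡ proj₂ x
  index-of-vertex x = cong proj₂ (Inverse.strictlyInverseʳ vertices x)

  abstract
    -- A walk from `u i` to `u j` has a step from an index at most `i` to a larger one;
    -- `Edge-narrow` shrinks that edge to the pair `i`, `j`.
    link : ∀ {i j} → suc (toℕ i) ≡ toℕ j → ∃ λ s → Edge s i j
    link {i} {j} 1+i≡j
      with v , w , adj , v≤i , w≰i ←
        crossing (λ v → toℕ (index-of v) ℕ.≤? toℕ i) (connected (u i) (u j))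
          (ℕₚ.≤-reflexive (cong toℕ (index-of-vertex (true , i))))
          (λ j≤i → ℕₚ.<⇒≱ (ℕₚ.≤-reflexive 1+i≡j)
                     (subst (_≤ toℕ i) (cong toℕ (index-of-vertex (true , j))) j≤i))
      with locate v | locate w
    ... | (s , a) , refl | (s′ , a′) , refl =
      s , Edge-narrow s v≤i (ℕₚ.≤-reflexive 1+i≡j)
            (subst (_≤ toℕ a′) 1+i≡j (ℕₚ.≰⇒> w≰i)) (adj⇒edge s s′ adj)

  3≤m : 3 ≤ m
  3≤m = ℕₚ.*-cancelˡ-≤ 2 (subst (6 ≤_) n≡2m 6≤n)

  -- There are at least three indices, so another link adjoins this one. If both kinds were present
  -- here, the adjoining link would repeat one of them, against `no-two-edges`.
  link-unique : ∀ s {i j} → suc (toℕ i) ≡ toℕ j → Edge s i j → ¬ Edge (not s) i j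
  link-unique s {i} {j} 1+i≡j e e′ with suc (toℕ j) ℕ.<? m
  ... | yes lt = let k , 1+j≡k = next j lt ; t , f = link 1+j≡k in clash (ℕₚ.≤-reflexive 1+j≡k) t f
    where
    clash : ∀ {k} → j <ᶠ k → ∀ t → ¬ Edge t j k
    clash j<k t f with t ≟ᵇ s
    ... | yes refl = no-two-edges s (ℕₚ.≤-reflexive 1+i≡j) j<k e f
    ... | no t≢s with refl ← ¬-not t≢s = no-two-edges (not s) (ℕₚ.≤-reflexive 1+i≡j) j<k e′ f
  -- Now `j` is the last index, and `3≤m` leaves room for an index before `i`.
  ... | no 1+j≮m = let h , 1+h≡i = previous i 0<i ; t , f = link 1+h≡i in clash (ℕₚ.≤-reflexive 1+h≡i) t f
    where
    0<i : 0 < toℕ i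
    0<i = s≤s⁻¹ (s≤s⁻¹ (ℕₚ.≤-trans 3≤m
            (subst (λ x → m ≤ suc x) (sym 1+i≡j) (ℕₚ.≮⇒≥ 1+j≮m))))

    clash : ∀ {h} → h <ᶠ i → ∀ t → ¬ Edge t h i
    clash h<i t f with t ≟ᵇ s
    ... | yes refl = no-two-edges s h<i (ℕₚ.≤-reflexive 1+i≡j) f e
    ... | no t≢s with refl ← ¬-not t≢s = no-two-edges (not s) h<i (ℕₚ.≤-reflexive 1+i≡j) f e′

  first second : Fin m
  first  = fromℕ< {0} (ℕₚ.≤-trans (s≤s z≤n) 3≤m)
  second = fromℕ< {1} (ℕₚ.≤-trans (s≤s (s≤s z≤n)) 3≤m)

  1+first≡second : suc (toℕ first) ≡ toℕ second
  1+first≡second = trans (cong suc (toℕ-fromℕ< _)) (sym (toℕ-fromℕ< _))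

  -- The kind of the first link, the only freedom left.
  b : Bool
  b = proj₁ (link 1+first≡second)

  link-alternates : ∀ {i j} → suc (toℕ i) ≡ toℕ j → Edge (alternating b (toℕ i)) i j
  link-alternates {i} {j} = go (toℕ i) refl
    where
    -- The index is carried as a natural number `x`, so that the induction runs on it and
    -- `alternating b x` reduces.
    go : ∀ x {i j} → toℕ i ≡ x → suc (toℕ i) ≡ toℕ j → Edge (alternating b x) i j
    go zero {i} {j} i≡0 1+i≡j = subst₂ (Edge b)
      (toℕ-injective (trans (toℕ-fromℕ< _) (sym i≡0)))
      (toℕ-injective (trans (toℕ-fromℕ< _) (trans (cong suc (sym i≡0)) 1+i≡j)))
      (proj₂ (link 1+first≡second))
    go (suc x) {i} {j} i≡1+x 1+i≡j
      with h , 1+h≡i ← previous i (subst (0 <_) (sym i≡1+x) z<s)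
      with t , f ← link 1+i≡j
      with t ≟ᵇ alternating b x
    ... | yes refl = contradiction f (no-two-edges t (ℕₚ.≤-reflexive 1+h≡i) (ℕₚ.≤-reflexive 1+i≡j)
                       (go x (ℕₚ.suc-injective (trans 1+h≡i i≡1+x)) 1+h≡i))
    ... | no t≢ with refl ← ¬-not t≢ = f

  -- An edge over a longer distance would narrow to two successive ones of the same kind. Between
  -- consecutive indices, `link-unique` rules out the kind that does not match the alternation.
  no-edge : ∀ s {i j} → i <ᶠ j → (suc (toℕ i) ≡ toℕ j → alternating b (toℕ i) ≡ not s) → ¬ Edge s i j
  no-edge s {i} {j} i<j far e with ℕₚ.m≤n⇒m<n∨m≡n i<j
  ... | inj₂ 1+i≡j = link-unique s 1+i≡j e
    (subst (λ t → Edge t i j) (far 1+i≡j) (link-alternates 1+i≡j))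
  ... | inj₁ 1+i<j =
    let k , 1+i≡k = next i (ℕₚ.<-trans 1+i<j (toℕ<n j))
        i<k = ℕₚ.≤-reflexive 1+i≡k
        k<j = subst (_< toℕ j) 1+i≡k 1+i<j
    in no-two-edges s i<k k<j (Edge-narrow s ℕₚ.≤-refl i<k (ℕₚ.<⇒≤ k<j) e)
                              (Edge-narrow s (ℕₚ.<⇒≤ i<k) k<j ℕₚ.≤-refl e)

  -- Recovering both orders from the links

  threshold≤⇒false : ∀ c {i j : Fin m} → threshold c (toℕ i) ≤ toℕ j → suc (toℕ i) ≡ toℕ j → c (toℕ i) ≡ false
  threshold≤⇒false c t≤j 1+i≡j =
    ¬-not λ ci → ℕₚ.<⇒≱ (<-threshold⁺ c (inj₂ (sym 1+i≡j , ci))) t≤j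

  threshold≤⇒< : ∀ c {i j : Fin m} → threshold c (toℕ i) ≤ toℕ j → i <ᶠ j
  threshold≤⇒< c = ℕₚ.<-≤-trans (<-threshold⁺ c (inj₁ ℕₚ.≤-refl))

  -- A minimal vertex lies below a maximal one by `d<u-≤` or through a link. Conversely, if `u i`
  -- failed to lie below `d j`, the two would form an edge excluded by `no-edge`.
  value-mono : ∀ x y → ByValue b x y → vertex x <ᶠ vertex y
  value-mono (true  , _) (true  , _) lt = U.mono lt
  value-mono (false , _) (false , _) lt = D.mono lt
  value-mono (false , j) (true  , i) lt with <-threshold⁻ (alternating b) lt
  ... | inj₁ j≤i = d<u-≤ j≤i
  ... | inj₂ (j≡1+i , ci) =
    proj₁ (subst (λ s → Edge s i j) ci (link-alternates (sym j≡1+i)))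
  value-mono (true  , i) (false , j) t≤j with <-cmp (u i) (d j)
  ... | tri< lt _ _ = lt
  ... | tri≈ _ eq _ = contradiction eq u≢d
  ... | tri> _ _ gt = contradiction (gt , pos-u<pos-d-≤ (ℕₚ.<⇒≤ i<j))
    (no-edge true i<j (threshold≤⇒false (alternating b) t≤j))
    where i<j = threshold≤⇒< (alternating b) t≤j

  position-mono : ∀ x y → ByPosition b x y → pos (vertex x) <ᶠ pos (vertex y)
  position-mono (true  , _) (true  , _) lt = pos-u-mono lt
  position-mono (false , _) (false , _) lt = pos-d-mono lt
  position-mono (true  , i) (false , j) lt with <-threshold⁻ (not ∘ alternating b) lt
  ... | inj₁ i≤j = pos-u<pos-d-≤ i≤j
  ... | inj₂ (i≡1+j , cj) =
    -- The bit is negated for positions, so the extra crossing comes from a link of kind `false`.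
    proj₂ (subst (λ s → Edge s j i) (trans (sym (not-involutive _)) (cong not cj))
             (link-alternates (sym i≡1+j)))
  position-mono (false , j) (true  , i) t≤i with <-cmp (pos (d j)) (pos (u i))
  ... | tri< lt _ _ = lt
  ... | tri≈ _ eq _ = contradiction (sym (pos-injective eq)) u≢d
  ... | tri> _ _ gt = contradiction (d<u-≤ (ℕₚ.<⇒≤ j<i) , gt)
    (no-edge false j<i λ 1+j≡i → trans (sym (not-involutive _))
      (cong not (threshold≤⇒false (not ∘ alternating b) t≤i 1+j≡i)))
    where j<i = threshold≤⇒< (not ∘ alternating b) t≤i

  layout : Layout m b π
  layout = record
    { label         = vertices
    ; value-mono    = λ {x} {y} → value-mono x y
    ; position-mono = λ {x} {y} → position-mono x y
    }

theorem7 : ∀ (n m : ℕ) → n ≡ 2 * m → 6 ≤ n →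
    (∀ (π : Permutation′ n) → Connected π → (DominationNumber π m ⇔ IsComb π))
    × Σ (Permutation′ n) (λ π₁ → Σ (Permutation′ n) (λ π₂ →
    ¬ SamePerm π₁ π₂
    × (Connected π₁ × DominationNumber π₁ m)
    × (Connected π₂ × DominationNumber π₂ m)
    × (∀ (π : Permutation′ n) → Connected π → DominationNumber π m →
    SamePerm π π₁ ⊎ SamePerm π π₂)))
theorem7 n m n≡2m 6≤n =
    (λ π connected → mk⇔ (λ γ → LayoutGraph.isComb {π = π} (proj₂ (extremal-layout π connected γ))) (comb-number π))
  , π₁ , π₂
  , layouts-differ {π = π₁} {π₂} (ℕₚ.*-cancelˡ-< 2 1 m (ℕₚ.≤-trans (s≤s (s≤s (s≤s z≤n))) (subst (6 ≤_) n≡2m 6≤n))) L₁ L₂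
  , comb-facts π₁ (LayoutGraph.isComb {π = π₁} L₁)
  , comb-facts π₂ (LayoutGraph.isComb {π = π₂} L₂)
  , λ π connected γ → classify π (extremal-layout π connected γ)
  where
  comb-number : ∀ π → IsComb π → DominationNumber π m
  comb-number π comb = subst (DominationNumber π) (Comb.size≡ π comb n≡2m) (Comb.dominationNumber π comb)

  comb-facts : ∀ π → IsComb π → Connected π × DominationNumber π m
  comb-facts π comb = Comb.connected π comb , comb-number π comb

  extremal-layout : ∀ π → Connected π → DominationNumber π m → ∃ λ b → Layout m b π
  extremal-layout π connected (_ , γ) = _ , Extremal.layout n≡2m 6≤n π connected γ

  π₁ π₂ : Permutation′ n
  π₁ = proj₁ (layout-exists m n≡2m true)
  π₂ = proj₁ (layout-exists m n≡2m false)

  L₁ : Layout m true π₁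
  L₁ = proj₂ (layout-exists m n≡2m true)

  L₂ : Layout m false π₂
  L₂ = proj₂ (layout-exists m n≡2m false)

  classify : ∀ π → (∃ λ b → Layout m b π) → SamePerm π π₁ ⊎ SamePerm π π₂
  classify π (true  , L) = inj₁ (layout-unique {π = π} {π₁} L L₁)
  classify π (false , L) = inj₂ (layout-unique {π = π} {π₂} L L₂)
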